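{- Let $M$ be a plane map rooted at a vertex $r$, and suppose $M$ is endowed with an orientation $O$ (possibly $k$-fractional for some integer $k\ge 1$) that is minimal and accessible. Then the edge set of $M$ admits a unique partition $(T_M, C_M)$ such that: (i) the edges of $T_M$ form a spanning tree of $M$, rooted at $r$, on which the restriction of $O$ is accessible (every vertex has an oriented path to $r$ using only edges of $T_M$); (ii) every edge $e\in C_M$ is saturated, and $e$ is oriented clockwise along the unique cycle it forms with edges of $T_M$, i.e. when this cycle is traversed in the direction of $e$, the outer face lies on its left.
   Context: A planar map is a proper embedding of a finite connected graph (loops and multiple edges allowed) in the sphere, up to orientation-preserving homeomorphism; a plane map is an embedding in the plane, equivalently a planar map with a distinguished unbounded face called the outer face. An orientation assigns a direction to each edge. For an integer $k\ge1$, the $k$-expanded map of $M$ replaces each edge by $k$ parallel copies; a $k$-fractional orientation of $M$ is an orientation of its $k$-expanded map in which two copies of the same edge never form a counterclockwise cycle; it is viewed as an orientation of $M$ in which each edge may be partially oriented in both directions ($k=1$ is an ordinary orientation). An edge is saturated if all its copies are oriented in the same direction. An oriented path is a path in which each edge is at least partially oriented in the direction of travel; oriented cycles are defined similarly. A clockwise (resp. counterclockwise) cycle is a simple oriented cycle with the outer face on its left (resp. on its right). An orientation is minimal if it has no counterclockwise cycle. An orientation of a vertex-rooted map is accessible if from every vertex there is an oriented path to the root vertex. -}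

module Defs where

open import Data.Nat using (ℕ; zero; suc; _+_; _≤_; _<_)
open import Data.Fin using (Fin; zero; suc; inject₁; fromℕ)
open import Data.Bool using (Bool; true; false; not)
open import Data.Product using (Σ; ∃; _×_; _,_; proj₁; proj₂)
open import Data.Sum using (_⊎_)
open import Relation.Nullary using (¬_)
open import Relation.Binary.PropositionalEquality using (_≡_)
open import Relation.Binary.Construct.Closure.ReflexiveTransitive using (Star)

iter : {A : Set} → (A → A) → ℕ → A → A
iter f zero    x = x
iter f (suc n) x = f (iter f n x)

-- Plane maps, encoded as combinatorial maps (rotation systems).
--
-- Edges are  Fin m ; each edge e has two darts (half-edges)  (e , true)
-- and (e , false).  α exchanges the two darts of an edge.  σ is the
-- permutation of darts giving the COUNTERCLOCKWISE cyclic order of darts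
-- around their tail vertex.  Vertices are the σ-orbits (labelled by
-- Fin nV via  vert ), faces are the φ-orbits with  φ = σ⁻¹ ∘ α
-- (labelled by Fin nF via  face ); with this convention the face
-- face d  is the face lying on the LEFT of dart d.  The map is connected
-- and of genus 0 (Euler: V + F = E + 2), i.e. a planar map; a plane map
-- additionally distinguishes the outer face.

Dart : ℕ → Set
Dart m = Fin m × Bool

α : {m : ℕ} → Dart m → Dart m
α (e , b) = (e , not b)

edgeOf : {m : ℕ} → Dart m → Fin m
edgeOf = proj₁

record PlaneMap : Set where
  field
    m      : ℕ
    σ      : Dart m → Dart m          -- ccw rotation around vertices
    σ⁻     : Dart m → Dart m
    σσ⁻    : ∀ d → σ (σ⁻ d) ≡ d
    σ⁻σ    : ∀ d → σ⁻ (σ d) ≡ d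
    nV     : ℕ
    vert   : Dart m → Fin nV
    vert-surj  : ∀ v → ∃ λ d → vert d ≡ v
    vert-orbit : ∀ d d' → (vert d ≡ vert d' → ∃ λ n → iter σ n d ≡ d')
                        × ((∃ λ n → iter σ n d ≡ d') → vert d ≡ vert d')
    nF     : ℕ
    face   : Dart m → Fin nF          -- face on the left of a dart
    face-surj  : ∀ f → ∃ λ d → face d ≡ f
    face-orbit : ∀ d d' → (face d ≡ face d' → ∃ λ n → iter (λ x → σ⁻ (α x)) n d ≡ d')
                        × ((∃ λ n → iter (λ x → σ⁻ (α x)) n d ≡ d') → face d ≡ face d')
    connected : ∀ d d' → Star (λ x y → (y ≡ σ x) ⊎ (y ≡ α x)) d d'
    euler  : nV + nF ≡ m + 2
    outer  : Fin nF

module _ (M : PlaneMap) where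
  open PlaneMap M

  tail head : Dart m → Fin nV
  tail d = vert d
  head d = vert (α d)

  record Cycle : Set where
    field
      len-1  : ℕ
      dart   : Fin (suc len-1) → Dart m
      chain  : ∀ (i : Fin len-1) → head (dart (inject₁ i)) ≡ tail (dart (suc i))
      close  : head (dart (fromℕ len-1)) ≡ tail (dart zero)
      simpleV : ∀ i j → tail (dart i) ≡ tail (dart j) → i ≡ j
      simpleE : ∀ i j → edgeOf (dart i) ≡ edgeOf (dart j) → i ≡ j

  open Cycle public

  DualAdjOff : Cycle → Fin nF → Fin nF → Set
  DualAdjOff c f g = ∃ λ d → (¬ ∃ λ i → edgeOf (dart c i) ≡ edgeOf d)
                             × face d ≡ f × face (α d) ≡ g

  -- The outer face lies on the left (resp. right) side of c, traversed
  -- in the direction of its darts: it lies in the region (connected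
  -- component of faces not separated by c) containing the face on the
  -- left (resp. right) of the first dart of c.
  OuterOnLeft OuterOnRight : Cycle → Set
  OuterOnLeft  c = Star (DualAdjOff c) (face (dart c zero)) outer
  OuterOnRight c = Star (DualAdjOff c) (face (α (dart c zero))) outer

  -- k-fractional orientations.  For each edge e, a e ∈ {0..k} is the
  -- number of its k copies oriented in the direction of the dart
  -- (e , true); the other k ∸ a e copies are oriented in the direction
  -- of (e , false).  (The condition that two copies of an edge never
  -- form a counterclockwise 2-cycle determines the orientation of the
  -- expanded map from these numbers.)

  record FracOrientation (k : ℕ) : Set where
    field
      amount : Fin m → ℕ
      bound  : ∀ e → amount e ≤ k

  module _ {k : ℕ} (O : FracOrientation k) where
    open FracOrientation O

    PartOriented : Dart m → Set
    PartOriented (e , true)  = 1 ≤ amount e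
    PartOriented (e , false) = amount e < k

    FullyOriented : Dart m → Set
    FullyOriented (e , true)  = amount e ≡ k
    FullyOriented (e , false) = amount e ≡ 0

    Saturated : Fin m → Set
    Saturated e = (amount e ≡ 0) ⊎ (amount e ≡ k)

    OrientedCycle : Cycle → Set
    OrientedCycle c = ∀ i → PartOriented (dart c i)

    Minimal : Set
    Minimal = ∀ (c : Cycle) → OrientedCycle c → ¬ OuterOnRight c

    OStep : (Fin m → Bool) → Fin nV → Fin nV → Set
    OStep S u w = ∃ λ d → tail d ≡ u × head d ≡ w
                        × S (edgeOf d) ≡ true × PartOriented d

    AccessibleIn : (Fin m → Bool) → Fin nV → Set
    AccessibleIn S r = ∀ v → Star (OStep S) v r

    Accessible : Fin nV → Set
    Accessible r = AccessibleIn (λ _ → true) r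

  -- Spanning trees, given by their edge set T (the complement C is the
  -- set of edges e with T e ≡ false).

  UStep : (Fin m → Bool) → Fin nV → Fin nV → Set
  UStep S u w = ∃ λ d → tail d ≡ u × head d ≡ w × S (edgeOf d) ≡ true

  IsSpanningTree : (Fin m → Bool) → Set
  IsSpanningTree T = (∀ u w → Star (UStep T) u w)
                   × (∀ (c : Cycle) → ¬ (∀ i → T (edgeOf (dart c i)) ≡ true))

  GoodPartition : {k : ℕ} → FracOrientation k → Fin nV → (Fin m → Bool) → Set
  GoodPartition O r T =
      (IsSpanningTree T × AccessibleIn O T r)
    × (∀ e → T e ≡ false →
          Saturated O e
        × (∀ d → edgeOf d ≡ e → FullyOriented O d →
             ∀ (c : Cycle) → dart c zero ≡ d →
             (∀ i → T (edgeOf (dart c (suc i))) ≡ true) →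
             OuterOnLeft c))

{-# OPTIONS --safe #-}
-- Fix for every face f a dual path to the outer face, and let ψ be the antisymmetric function on
-- darts that counts the signed crossings with all these paths.  By the Jordan curve theorem, ψ sums
-- along a simple cycle to minus the number of faces on its right if the outer face lies on its left,
-- and to the number of faces on its left if the outer face lies on its right.  By minimality every
-- oriented cycle has negative ψ-sum, so the maximal ψ-weight g(v) of an oriented walk from v to r is
-- well defined, and T consists of the edges on which ψ is the difference of g at the two ends.
-- The heaviest walks lie in T; a cycle in T would have ψ-sum 0; and the cycle that an
-- oriented dart d outside T closes with T has ψ-sum ψ(d) + g(head d) - g(tail d) < 0.  Conversely,
-- the tree of any good partition determines, by the ψ-weights of its paths to r, a potential that
-- satisfies the same Bellman equation, hence equals g.
module Submission where

open import Defs
open import Data.Nat as ℕ using (ℕ; zero; suc; _+_; _*_; _≤_; z≤n; s≤s)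
import Data.Nat.Properties as ℕₚ
import Data.Nat.Tactic.RingSolver as ℕ-Solver
open import Data.Integer as ℤ using (ℤ; 0ℤ; 1ℤ)
import Data.Integer.Properties as ℤₚ
open import Data.Integer.Tactic.RingSolver using (solve-∀)
open import Algebra.Properties.AbelianGroup ℤₚ.+-0-abelianGroup using (∙-cancelˡ)
open import Algebra.Properties.CommutativeMonoid.Sum ℤₚ.+-0-commutativeMonoid
  using (sum; sum-cong-≗; ∑-distrib-+; ∑-comm; sum-replicate-zero)
open import Data.Fin as Fin using (Fin; zero; suc; inject₁; fromℕ; combine)
import Data.Fin.Properties as Finₚ
open import Data.Fin.Induction using (<-weakInduction)
open import Data.Fin.Relation.Unary.Top using (view; ‵fromℕ; ‵inject₁)
open import Data.Bool using (Bool; true; false; if_then_else_)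
import Data.Bool.Properties as Boolₚ
open import Data.Product using (Σ; ∃; _×_; _,_; proj₁; proj₂)
open import Data.Product.Properties using (≡-dec)
open import Data.Sum using (_⊎_; inj₁; inj₂; [_,_]′)
open import Data.Empty using (⊥-elim)
open import Data.List using (List; []; _∷_; _++_; _ʳ++_; length; lookup; map; concatMap; filter; allFin; tabulate; cartesianProduct)
open import Data.List.Properties using (length-++; length-tabulate)
open import Data.List.Extrema ℤₚ.≤-totalOrder using (argmax; v≤f[argmax]⁺)
open import Data.List.Membership.Propositional using (_∈_; _∉_; find)
open import Data.List.Membership.Propositional.Properties
  using (∈-∃++; ∈-++⁻; ∈-++⁺ˡ; ∈-++⁺ʳ; ∈-filter⁺; ∈-filter⁻; ∈-allFin; ∈-tabulate⁺; ∈-tabulate⁻; ∈-cartesianProduct⁺; ∈-lookup)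
open import Data.List.Relation.Binary.Subset.Propositional using (_⊆_)
open import Data.List.Relation.Unary.Any as Any using (Any; here; there)
import Data.List.Relation.Unary.Any.Properties as Anyₚ
open import Data.List.Relation.Unary.All as All using (All; []; _∷_)
open import Data.List.Relation.Unary.All.Properties using (¬Any⇒All¬)
open import Data.List.Relation.Unary.AllPairs using (AllPairs; []; _∷_)
open import Data.List.Relation.Unary.Unique.Propositional using (Unique)
import Data.List.Relation.Unary.Unique.Propositional.Properties as Uniqueₚ
open import Function using (_∘_; id)
open import Relation.Nullary using (¬_; Dec; yes; no; does)
open import Relation.Nullary.Decidable using (¬?; dec-true; dec-false)
open import Relation.Binary using (Sym)
open import Relation.Binary.PropositionalEquality
import Relation.Binary.Construct.Closure.ReflexiveTransitive as Star
open Star using (Star; ε; _◅_; _◅◅_)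

-- Finite sets and component labels

unique⊆⇒length≤ : {A : Set} {xs ys : List A} → Unique xs → xs ⊆ ys → length xs ≤ length ys
unique⊆⇒length≤ [] _ = z≤n
unique⊆⇒length≤ {xs = x ∷ xs} (x≢ ∷ u) xs⊆ys with ∈-∃++ (xs⊆ys (here refl))
... | as , bs , refl = subst (suc (length xs) ≤_) (sym eq) (s≤s (unique⊆⇒length≤ u rest))
  where
  eq : length (as ++ x ∷ bs) ≡ suc (length (as ++ bs))
  eq = trans (length-++ as) (trans (ℕₚ.+-suc (length as) (length bs)) (cong suc (sym (length-++ as))))
  rest : xs ⊆ as ++ bs
  rest y∈xs with ∈-++⁻ as (xs⊆ys (there y∈xs))
  ... | inj₁ y∈as            = ∈-++⁺ˡ y∈as
  ... | inj₂ (here refl)     = ⊥-elim (All.lookup x≢ y∈xs refl)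
  ... | inj₂ (there y∈bs)    = ∈-++⁺ʳ as y∈bs

unique⇒length≤ : ∀ {n} {xs : List (Fin n)} → Unique xs → length xs ≤ n
unique⇒length≤ {n} {xs} u =
  subst (length xs ≤_) (length-tabulate {n = n} id) (unique⊆⇒length≤ u (λ _ → ∈-allFin _))

iter-cancel : {A : Set} {f : A → A} → (∀ {x y} → f x ≡ f y → x ≡ y) →
  ∀ {x} i {j} → iter f i x ≡ iter f (i + j) x → x ≡ iter f j x
iter-cancel inj zero    eq = eq
iter-cancel inj (suc i) eq = iter-cancel inj i (inj eq)

-- Two of the first `N + 1` iterates coincide by the pigeonhole principle, and injectivity cancels
-- their common prefix. The exponent is positive, so the closed walk in `contour` has a last step.
iter-returns : {A : Set} {N : ℕ} (code : A → Fin N) → (∀ {x y} → code x ≡ code y → x ≡ y) →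
  {f : A → A} → (∀ {x y} → f x ≡ f y → x ≡ y) → ∀ x → ∃ λ n → iter f (suc n) x ≡ x
iter-returns {N = N} code code-inj {f} f-inj x
  with Finₚ.pigeonhole {m = N} {n = suc N} (ℕₚ.n<1+n N) (λ i → code (iter f (Fin.toℕ i) x))
... | i , j , i<j , eq with ℕₚ.m≤n⇒∃[o]m+o≡n i<j
...   | k , 1+i+k≡j = k , sym (iter-cancel f-inj (Fin.toℕ i) (trans (code-inj eq) (cong (λ n → iter f n x) j≡)))
  where
  j≡ : Fin.toℕ j ≡ Fin.toℕ i + suc k
  j≡ = trans (sym 1+i+k≡j) (sym (ℕₚ.+-suc (Fin.toℕ i) k))

module Components {E : Set} {n : ℕ} (s t : E → Fin n) where

  recolour : Fin n → Fin n → Fin n → Fin n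
  recolour a b x = if does (x Finₚ.≟ a) then b else x

  recolour-old : ∀ a b → recolour a b a ≡ b
  recolour-old a b rewrite dec-true (a Finₚ.≟ a) refl = refl

  recolour-new : ∀ a b → recolour a b b ≡ b
  recolour-new a b with b Finₚ.≟ a
  ... | yes _ = refl
  ... | no _  = refl

  recolour-other : ∀ {a b x} → x ≢ a → recolour a b x ≡ x
  recolour-other {a} {b} {x} x≢a rewrite dec-false (x Finₚ.≟ a) x≢a = refl

  -- A naive union-find: `label es v` is the representative of the component of `v` in the graph
  -- with edge list `es`. Adding an edge redirects the representative at its source to the one at
  -- its target.
  label : List E → Fin n → Fin n
  label []       v = v
  label (e ∷ es) v = recolour (label es (s e)) (label es (t e)) (label es v)

  label-∈ : ∀ {e es} → e ∈ es → label es (s e) ≡ label es (t e)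
  label-∈ {e} {_ ∷ es} (here refl)  =
    trans (recolour-old (label es (s e)) (label es (t e))) (sym (recolour-new (label es (s e)) (label es (t e))))
  label-∈ {es = e' ∷ es} (there e∈) = cong (recolour _ _) (label-∈ e∈)

  -- The representatives, one for each component, so that `#roots` is the number of components.
  roots : List E → List (Fin n)
  roots es = filter (λ v → label es v Finₚ.≟ v) (allFin n)

  ∈-roots : ∀ es {v} → label es v ≡ v → v ∈ roots es
  ∈-roots es = ∈-filter⁺ (λ v → label es v Finₚ.≟ v) (∈-allFin _)

  roots-∈ : ∀ es {v} → v ∈ roots es → label es v ≡ v
  roots-∈ es v∈ = proj₂ (∈-filter⁻ (λ v → label es v Finₚ.≟ v) {xs = allFin n} v∈)

  roots-unique : ∀ es → Unique (roots es)
  roots-unique es = Uniqueₚ.filter⁺ (λ v → label es v Finₚ.≟ v) (Uniqueₚ.allFin⁺ n)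

  #roots : List E → ℕ
  #roots es = length (roots es)

  #roots-[] : n ≤ #roots []
  #roots-[] = subst (_≤ #roots []) (length-tabulate {n = n} id)
    (unique⊆⇒length≤ (Uniqueₚ.allFin⁺ n) (λ _ → ∈-roots [] refl))

  -- The only representative that a new edge can remove is the one at its source.
  #roots-∷ : ∀ e es → #roots es ≤ suc (#roots (e ∷ es))
  #roots-∷ e es = unique⊆⇒length≤ {ys = label es (s e) ∷ roots (e ∷ es)} (roots-unique es) sub
    where
    sub : roots es ⊆ label es (s e) ∷ roots (e ∷ es)
    sub {v} v∈ with v Finₚ.≟ label es (s e)
    ... | yes eq = here eq
    ... | no v≢  = there (∈-roots (e ∷ es) (trans (cong (recolour _ _) (roots-∈ es v∈)) (recolour-other v≢)))

  #roots-redundant : ∀ e es → label es (s e) ≡ label es (t e) → #roots es ≤ #roots (e ∷ es)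
  #roots-redundant e es same = unique⊆⇒length≤ (roots-unique es) sub
    where
    sub : roots es ⊆ roots (e ∷ es)
    sub {v} v∈ with label es v Finₚ.≟ label es (s e) | roots-∈ es v∈
    ... | yes eq | root = ∈-roots (e ∷ es) (trans (cong (recolour _ _) eq)
                            (trans (recolour-old (label es (s e)) (label es (t e))) (trans (sym same) (trans (sym eq) root))))
    ... | no neq | root = ∈-roots (e ∷ es) (trans (recolour-other neq) root)

  #roots-length : ∀ es → n ≤ #roots es + length es
  #roots-length []       = ℕₚ.≤-trans #roots-[] (ℕₚ.m≤m+n _ 0)
  #roots-length (e ∷ es) = ℕₚ.≤-trans (#roots-length es)
    (ℕₚ.≤-trans (ℕₚ.+-monoˡ-≤ (length es) (#roots-∷ e es)) (ℕₚ.≤-reflexive (sym (ℕₚ.+-suc _ _))))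

  #roots-connected : ∀ es → (∀ u v → label es u ≡ label es v) → #roots es ≤ 1
  #roots-connected es conn = go (roots es) (roots-unique es) (roots-∈ es)
    where
    go : ∀ vs → Unique vs → (∀ {v} → v ∈ vs → label es v ≡ v) → length vs ≤ 1
    go []           _ _ = z≤n
    go (v ∷ [])     _ _ = s≤s z≤n
    go (v ∷ w ∷ vs) ((v≢w ∷ _) ∷ _) root =
      ⊥-elim (v≢w (trans (sym (root (here refl))) (trans (conn v w) (root (there (here refl))))))

-- Planar maps: Euler counting and the Jordan curve theorem

module _ {m : ℕ} where

  infix 4 _≟ᵈ_
  _≟ᵈ_ : (d d' : Dart m) → Dec (d ≡ d')
  _≟ᵈ_ = ≡-dec Finₚ._≟_ Boolₚ._≟_

  αα : (d : Dart m) → α (α d) ≡ d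
  αα (e , b) = cong (e ,_) (Boolₚ.not-involutive b)

  α-injective : {d d' : Dart m} → α d ≡ α d' → d ≡ d'
  α-injective {d} {d'} eq = trans (sym (αα d)) (trans (cong α eq) (αα d'))

  d≢αd : (d : Dart m) → d ≢ α d
  d≢αd (e , true)  ()
  d≢αd (e , false) ()

  sameEdge : {d d' : Dart m} → edgeOf d ≡ edgeOf d' → d ≡ d' ⊎ d ≡ α d'
  sameEdge {e , true}  {.e , true}  refl = inj₁ refl
  sameEdge {e , true}  {.e , false} refl = inj₂ refl
  sameEdge {e , false} {.e , true}  refl = inj₂ refl
  sameEdge {e , false} {.e , false} refl = inj₁ refl

  dartCode : Dart m → Fin (m * 2)
  dartCode (e , b) = combine e (if b then zero else suc zero)

  dartCode-injective : ∀ {d d'} → dartCode d ≡ dartCode d' → d ≡ d'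
  dartCode-injective {e , b} {e' , b'} eq
    with Finₚ.combine-injective e (if b then zero else suc zero) e' (if b' then zero else suc zero) eq
  dartCode-injective {e , true}  {.e , true}  eq | refl , _ = refl
  dartCode-injective {e , false} {.e , false} eq | refl , _ = refl
  dartCode-injective {e , true}  {.e , false} eq | refl , ()
  dartCode-injective {e , false} {.e , true}  eq | refl , ()

module Planar (M : PlaneMap) where
  open PlaneMap M
  open import Data.List.Membership.DecPropositional (Finₚ._≟_ {n = m}) using (_∈?_)

  σ-injective : ∀ {x y} → σ x ≡ σ y → x ≡ y
  σ-injective {x} {y} eq = trans (sym (σ⁻σ x)) (trans (cong σ⁻ eq) (σ⁻σ y))

  vert-σ : ∀ x → vert (σ x) ≡ vert x
  vert-σ x = sym (proj₂ (vert-orbit x (σ x)) (1 , refl))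

  -- Because `φ` sends `α (σ x)` to `x`: the corner between `x` and its successor lies to the left
  -- of `x` and to the right of `σ x`.
  face-ασ : ∀ x → face (α (σ x)) ≡ face x
  face-ασ x = proj₂ (face-orbit (α (σ x)) x) (1 , trans (cong σ⁻ (αα (σ x))) (σ⁻σ x))

  module V = Components {E = Fin m} (λ e → vert (e , true)) (λ e → vert (e , false))
  module F = Components {E = Fin m} (λ e → face (e , true)) (λ e → face (e , false))

  V-label : ∀ {es} d → edgeOf d ∈ es → V.label es (vert d) ≡ V.label es (vert (α d))
  V-label (e , true)  e∈ = V.label-∈ e∈
  V-label (e , false) e∈ = sym (V.label-∈ e∈)

  F-label : ∀ {es} d → edgeOf d ∈ es → F.label es (face d) ≡ F.label es (face (α d))
  F-label (e , true)  e∈ = F.label-∈ e∈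
  F-label (e , false) e∈ = sym (F.label-∈ e∈)

  V-all : ∀ {es} → (∀ e → e ∈ es) → ∀ u v → V.label es u ≡ V.label es v
  V-all {es} all u v with vert-surj u | vert-surj v
  ... | x , refl | y , refl = go (connected x y)
    where
    go : ∀ {x y} → Star (λ x y → (y ≡ σ x) ⊎ (y ≡ α x)) x y → V.label es (vert x) ≡ V.label es (vert y)
    go ε = refl
    go {x} (inj₁ refl ◅ ps) = trans (cong (V.label es) (sym (vert-σ x))) (go ps)
    go {x} (inj₂ refl ◅ ps) = trans (V-label x (all (edgeOf x))) (go ps)

  -- Walk along the contour of the component of d's tail in the graph with edge set as: the walk
  -- starts on the left of d, crosses no edge of as, and as it is a permutation it comes back to d,
  -- from the right.
  contour : ∀ {as bs} d → (∀ e → e ≢ edgeOf d → e ∈ as ⊎ e ∈ bs) →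
    V.label as (vert d) ≢ V.label as (vert (α d)) →
    F.label bs (face d) ≡ F.label bs (face (α d))
  contour {as} {bs} d cover apart = last-step (proj₁ returns) (proj₂ returns)
    where
    d∉as : edgeOf d ∉ as
    d∉as d∈ = apart (V-label d d∈)

    turn : Dart m → Dart m
    turn y = if does (edgeOf y ∈? as) then α y else y

    turn-involutive : ∀ y → turn (turn y) ≡ y
    turn-involutive y with edgeOf y ∈? as in eq
    ... | yes _ rewrite cong does eq = αα y
    ... | no  _ rewrite cong does eq = refl

    -- Rotate to the next dart; if its edge is in `as`, pass to the other end of that edge,
    -- otherwise stay at the vertex and cross the edge.
    τ : Dart m → Dart m
    τ x = turn (σ x)

    τ-injective : ∀ {x y} → τ x ≡ τ y → x ≡ y
    τ-injective {x} {y} eq = σ-injective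
      (trans (sym (turn-involutive (σ x))) (trans (cong turn eq) (turn-involutive (σ y))))

    Goal : Set
    Goal = F.label bs (face d) ≡ F.label bs (face (α d))

    Inv : Dart m → Set
    Inv x = V.label as (vert x) ≡ V.label as (vert d) × F.label bs (face x) ≡ F.label bs (face d)

    finish : ∀ {x} → Inv x → σ x ≡ d → Goal
    finish {x} (_ , f) refl = sym (trans (cong (F.label bs) (face-ασ x)) f)

    step : ∀ {x} → Inv x → Goal ⊎ Inv (τ x)
    step {x} inv@(v , f) with edgeOf (σ x) ∈? as
    ... | yes y∈ = inj₂ ( trans (sym (V-label (σ x) y∈)) (trans (cong (V.label as) (vert-σ x)) v)
                        , trans (cong (F.label bs) (face-ασ x)) f)
    ... | no y∉ with edgeOf (σ x) Finₚ.≟ edgeOf d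
    ...   | no y≢d with cover (edgeOf (σ x)) y≢d
    ...     | inj₁ y∈as = ⊥-elim (y∉ y∈as)
    ...     | inj₂ y∈bs = inj₂ ( trans (cong (V.label as) (vert-σ x)) v
                               , trans (F-label (σ x) y∈bs) (trans (cong (F.label bs) (face-ασ x)) f))
    step {x} inv@(v , f) | no y∉ | yes y≡d with sameEdge {d = σ x} {d' = d} y≡d
    ...     | inj₁ y≡  = inj₁ (finish inv y≡)
    -- Meeting `α d` would put the head of `d` into the component of its tail.
    ...     | inj₂ y≡α = ⊥-elim (apart (sym (trans (cong (V.label as) (trans (cong vert (sym y≡α)) (vert-σ x))) v)))

    run : ∀ n → Goal ⊎ Inv (iter τ n d)
    run zero    = inj₂ (refl , refl)
    run (suc n) = [ inj₁ , step ]′ (run n)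

    returns : ∃ λ n → iter τ (suc n) d ≡ d
    returns = iter-returns dartCode dartCode-injective τ-injective d

    last-step : ∀ n → iter τ (suc n) d ≡ d → Goal
    last-step n eq with run n
    ... | inj₁ goal = goal
    ... | inj₂ inv with edgeOf (σ (iter τ n d)) ∈? as
    -- A return to `d` through an edge of `as` would put the edge of `d` itself into `as`.
    ...   | yes y∈ = ⊥-elim (d∉as (subst (λ z → edgeOf z ∈ as) eq y∈))
    ...   | no _   = finish inv eq

  -- Inserting the edges bs one by one into the primal graph while deleting them from the dual one:
  -- by contour, no edge merges components on both sides.
  sweep : ∀ as bs → (∀ e → e ∈ as ⊎ e ∈ bs) →
    nF + V.#roots as ≤ F.#roots bs + V.#roots (bs ʳ++ as) + length bs
  sweep as [] cover = ℕₚ.≤-trans (ℕₚ.+-monoˡ-≤ (V.#roots as) F.#roots-[]) (ℕₚ.≤-reflexive (sym (ℕₚ.+-identityʳ _)))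
  sweep as (e ∷ bs) cover = combine-steps nF (F.#roots bs) (F.#roots (e ∷ bs)) (V.#roots as) (V.#roots (e ∷ as)) _ (length bs)
      (sweep (e ∷ as) bs cover') one-step
    where
    cover' : ∀ e' → e' ∈ e ∷ as ⊎ e' ∈ bs
    cover' e' with cover e'
    ... | inj₁ ∈as          = inj₁ (there ∈as)
    ... | inj₂ (here refl)  = inj₁ (here refl)
    ... | inj₂ (there ∈bs)  = inj₂ ∈bs

    others : ∀ e' → e' ≢ e → e' ∈ as ⊎ e' ∈ bs
    others e' e'≢e with cover e'
    ... | inj₁ ∈as          = inj₁ ∈as
    ... | inj₂ (here eq)    = ⊥-elim (e'≢e eq)
    ... | inj₂ (there ∈bs)  = inj₂ ∈bs

    one-step : F.#roots bs + V.#roots as ≤ F.#roots (e ∷ bs) + V.#roots (e ∷ as) + 1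
    one-step with V.label as (vert (e , true)) Finₚ.≟ V.label as (vert (e , false))
    ... | yes same = ℕₚ.≤-trans (ℕₚ.+-mono-≤ (F.#roots-∷ e bs) (V.#roots-redundant e as same))
                       (ℕₚ.≤-reflexive (ℕₚ.+-comm 1 _))
    ... | no apart = ℕₚ.≤-trans
                       (ℕₚ.+-mono-≤ (F.#roots-redundant e bs (contour (e , true) others apart)) (V.#roots-∷ e as))
                       (ℕₚ.≤-reflexive (trans (ℕₚ.+-suc _ _) (ℕₚ.+-comm 1 _)))

    combine-steps : ∀ f₀ f₁ f₂ v₀ v₁ z l → f₀ + v₁ ≤ f₁ + z + l → f₁ + v₀ ≤ f₂ + v₁ + 1 →
      f₀ + v₀ ≤ f₂ + z + suc l
    combine-steps f₀ f₁ f₂ v₀ v₁ z l p q = ℕₚ.+-cancelʳ-≤ (f₁ + v₁) _ _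
      -- The two inequalities are added, and the intermediate counts `f₁ + v₁` cancel.
      (ℕₚ.≤-trans (ℕₚ.≤-reflexive (lhs f₀ v₀ f₁ v₁)) (ℕₚ.≤-trans (ℕₚ.+-mono-≤ p q) (ℕₚ.≤-reflexive (rhs f₁ z l f₂ v₁))))
      where
      lhs : ∀ a b c d → (a + b) + (c + d) ≡ (a + d) + (c + b)
      lhs = ℕ-Solver.solve-∀
      rhs : ∀ f₁ z l f₂ v₁ → (f₁ + z + l) + (f₂ + v₁ + 1) ≡ (f₂ + z + suc l) + (f₁ + v₁)
      rhs = ℕ-Solver.solve-∀

  -- The two sides of a simple cycle

  module OffCycle (c : Cycle M) where
    d₀ : Dart m
    d₀ = dart c zero

    OnCycle : Fin m → Set
    OnCycle e = ∃ λ i → edgeOf (dart c i) ≡ e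

    onCycle? : ∀ e → Dec (OnCycle e)
    onCycle? e = Finₚ.any? (λ i → edgeOf (dart c i) Finₚ.≟ e)

    infix 4 _~_
    _~_ : Fin nF → Fin nF → Set
    _~_ = Star (DualAdjOff M c)

    adj-sym : Sym (DualAdjOff M c) (DualAdjOff M c)
    adj-sym (d , off , f , g) = α d , off , g , trans (cong face (αα d)) f

    ~-sym : ∀ {f g} → f ~ g → g ~ f
    ~-sym = Star.reverse adj-sym

    ~-refl′ : ∀ {f g} → f ≡ g → f ~ g
    ~-refl′ refl = ε

    cross : ∀ {d} → ¬ OnCycle (edgeOf d) → face d ~ face (α d)
    cross {d} off = (d , off , refl , refl) ◅ ε

    rotate-step : ∀ x → ¬ OnCycle (edgeOf (σ x)) → face x ~ face (σ x)
    rotate-step x off = ~-refl′ (sym (face-ασ x)) ◅◅ ~-sym (cross off)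

    -- Turning counterclockwise from `a`, every edge passed before `b` is off the cycle, so the turn
    -- leads from the left of `a` to the right of `b` without crossing the cycle.
    rotate : ∀ a b → vert a ≡ vert b → a ≢ b →
      (∀ y → vert y ≡ vert a → OnCycle (edgeOf y) → y ≡ a ⊎ y ≡ b) → face a ~ face (α b)
    rotate a b va≡vb a≢b only with proj₁ (vert-orbit a b) va≡vb
    ... | zero  , a≡b = ⊥-elim (a≢b a≡b)
    ... | suc n , eq = [ id , (λ p → p ◅◅ ~-refl′ (trans (sym (face-ασ _)) (cong (face ∘ α) eq))) ]′ (run n)
      where
      vert-iter : ∀ k → vert (iter σ k a) ≡ vert a
      vert-iter zero    = refl
      vert-iter (suc k) = trans (vert-σ _) (vert-iter k)

      run : ∀ k → face a ~ face (α b) ⊎ face a ~ face (iter σ k a)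
      run zero = inj₂ ε
      run (suc k) with run k
      ... | inj₁ goal = inj₁ goal
      ... | inj₂ p with onCycle? (edgeOf (σ (iter σ k a)))
      ...   | no off = inj₂ (p ◅◅ rotate-step _ off)
      ...   | yes on with only _ (vert-iter (suc k)) on
      -- A full turn back to `a` starts afresh.
      ...     | inj₁ y≡a = inj₂ (~-refl′ (cong face (sym y≡a)))
      ...     | inj₂ y≡b = inj₁ (p ◅◅ ~-refl′ (trans (sym (face-ασ _)) (cong (face ∘ α) y≡b)))

    head-consecutive : ∀ i j → head M (dart c j) ≡ tail M (dart c (suc i)) → j ≡ inject₁ i
    head-consecutive i j eq with view j
    ... | ‵inject₁ j' = cong inject₁ (Finₚ.suc-injective (simpleV c _ _ (trans (sym (chain c j')) eq)))
    ... | ‵fromℕ with simpleV c zero (suc i) (trans (sym (close c)) eq)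
    ...   | ()

    at-corner : ∀ i y → vert y ≡ tail M (dart c (suc i)) → OnCycle (edgeOf y) →
      y ≡ dart c (suc i) ⊎ y ≡ α (dart c (inject₁ i))
    at-corner i y vy (j , eq) with sameEdge {d = y} {d' = dart c j} (sym eq)
    ... | inj₁ refl = inj₁ (cong (dart c) (simpleV c j (suc i) vy))
    ... | inj₂ refl = inj₂ (cong (α ∘ dart c) (head-consecutive i j vy))

    corner-≢ : ∀ i → dart c (suc i) ≢ α (dart c (inject₁ i))
    corner-≢ i eq = d≢αd (dart c (inject₁ i)) (trans (cong (dart c) same) eq)
      where
      same : inject₁ i ≡ suc i
      same = sym (simpleE c (suc i) (inject₁ i) (cong edgeOf eq))

    -- At each corner, the counterclockwise turn from the outgoing dart to the reversed incoming one
    -- sweeps the left side. The complementary turn gives `right-side`.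
    left-side : ∀ i → face d₀ ~ face (dart c i)
    left-side = <-weakInduction (λ i → face d₀ ~ face (dart c i)) ε λ i p →
      p ◅◅ ~-sym (rotate (dart c (suc i)) (α (dart c (inject₁ i))) (sym (chain c i)) (corner-≢ i) (at-corner i)
                  ◅◅ ~-refl′ (cong face (αα (dart c (inject₁ i)))))

    right-side : ∀ i → face (α d₀) ~ face (α (dart c i))
    right-side = <-weakInduction (λ i → face (α d₀) ~ face (α (dart c i))) ε λ i p →
      p ◅◅ rotate (α (dart c (inject₁ i))) (dart c (suc i)) (chain c i) (corner-≢ i ∘ sym)
             (λ y vy on → [ inj₂ , inj₁ ]′ (at-corner i y (trans vy (chain c i)) on))

    Sided : Dart m → Set
    Sided x = face d₀ ~ face x ⊎ face (α d₀) ~ face x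

    on-sided : ∀ x → OnCycle (edgeOf x) → Sided x
    on-sided x (i , eq) with sameEdge {d = x} {d' = dart c i} (sym eq)
    ... | inj₁ refl = inj₁ (left-side i)
    ... | inj₂ refl = inj₂ (right-side i)

    -- Propagated from `d₀` through the connected map: a step over an edge off the cycle keeps the
    -- side, and at an edge of the cycle `on-sided` decides anew.
    sided : ∀ x → Sided x
    sided x = go (connected d₀ x) (inj₁ ε)
      where
      extend : ∀ {x y} → face x ~ face y → Sided x → Sided y
      extend q = [ (λ p → inj₁ (p ◅◅ q)) , (λ p → inj₂ (p ◅◅ q)) ]′

      go : ∀ {x y} → Star (λ x y → (y ≡ σ x) ⊎ (y ≡ α x)) x y → Sided x → Sided y
      go ε s = s
      go {x} (inj₁ refl ◅ ps) s with onCycle? (edgeOf (σ x))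
      ... | yes on = go ps (on-sided (σ x) on)
      ... | no off = go ps (extend (rotate-step x off) s)
      go {x} (inj₂ refl ◅ ps) s with onCycle? (edgeOf x)
      ... | yes on = go ps (on-sided (α x) on)
      ... | no off = go ps (extend (cross off) s)

    two-sides : ∀ f → face d₀ ~ f ⊎ face (α d₀) ~ f
    two-sides f with face-surj f
    ... | x , refl = sided x

    -- The first edge of the cycle is kept out of `rest`, since the count in `jordan` exploits that
    -- inserting it after `rest` merges nothing.
    rest off : List (Fin m)
    rest = tabulate (λ i → edgeOf (dart c (suc i)))
    off  = filter (λ e → ¬? (onCycle? e)) (allFin m)

    ∈-off : ∀ {e} → ¬ OnCycle e → e ∈ off
    ∈-off = ∈-filter⁺ (λ e → ¬? (onCycle? e)) (∈-allFin _)

    off-∈ : ∀ {e} → e ∈ off → ¬ OnCycle e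
    off-∈ e∈ = proj₂ (∈-filter⁻ (λ e → ¬? (onCycle? e)) {xs = allFin m} e∈)

    covered : ∀ e → e ∈ edgeOf d₀ ∷ rest ⊎ e ∈ off
    covered e with onCycle? e
    ... | yes (zero  , refl) = inj₁ (here refl)
    ... | yes (suc i , refl) = inj₁ (there (∈-tabulate⁺ i))
    ... | no ∉               = inj₂ (∈-off ∉)

    few-edges : suc (length rest) + length off ≤ m
    few-edges = subst (_≤ m) (length-++ (edgeOf d₀ ∷ rest)) (unique⇒length≤ unique)
      where
      disjoint : ∀ {e} → ¬ (e ∈ edgeOf d₀ ∷ rest × e ∈ off)
      disjoint (here refl , e∈off) = off-∈ e∈off (zero , refl)
      disjoint (there e∈ , e∈off) with ∈-tabulate⁻ e∈
      ... | i , refl = off-∈ e∈off (suc i , refl)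

      unique : Unique ((edgeOf d₀ ∷ rest) ++ off)
      unique = Uniqueₚ.++⁺
        (Uniqueₚ.tabulate⁺ {f = λ i → edgeOf (dart c i)} (λ {i} {j} → simpleE c i j))
        (Uniqueₚ.filter⁺ (λ e → ¬? (onCycle? e)) (Uniqueₚ.allFin⁺ m)) disjoint

    -- The rest of the cycle is a path between the two ends of its first edge.
    closes : V.label rest (vert (edgeOf d₀ , true)) ≡ V.label rest (vert (edgeOf d₀ , false))
    closes = orient d₀ (sym (trans (along (fromℕ _)) (cong lab (close c))))
      where
      lab : Fin nV → Fin nV
      lab = V.label rest

      along : ∀ i → lab (head M d₀) ≡ lab (head M (dart c i))
      along = <-weakInduction (λ i → lab (head M d₀) ≡ lab (head M (dart c i))) refl λ i eq →
        trans eq (trans (cong lab (chain c i)) (V-label (dart c (suc i)) (∈-tabulate⁺ i)))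

      orient : ∀ d → lab (tail M d) ≡ lab (head M d) → lab (vert (edgeOf d , true)) ≡ lab (vert (edgeOf d , false))
      orient (e , true)  eq = eq
      orient (e , false) eq = sym eq

    F-off : ∀ {f g} → f ~ g → F.label off f ≡ F.label off g
    F-off ε = refl
    F-off ((d , d∉ , refl , refl) ◅ ps) = trans (F-label d (∈-off d∉)) (F-off ps)

    -- If the two sides met, the first edge of the cycle would neither merge two components of the
    -- graph when it is inserted nor merge two faces when it is deleted, leaving at most m - 1
    -- mergers for the (nV - 1) + (nF - 1) = m that are needed.
    jordan : ¬ (face d₀ ~ face (α d₀))
    jordan meet = ℕₚ.<-irrefl refl (begin-strict
      m + 2                                           ≡⟨ sym euler ⟩
      nV + nF                                         ≤⟨ ℕₚ.+-monoˡ-≤ nF (V.#roots-length rest) ⟩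
      (V.#roots rest + length rest) + nF              ≤⟨ ℕₚ.+-monoˡ-≤ nF (ℕₚ.+-monoˡ-≤ (length rest) (V.#roots-redundant (edgeOf d₀) rest closes)) ⟩
      (V.#roots as + length rest) + nF                ≡⟨ shuffle (V.#roots as) (length rest) nF ⟩
      (nF + V.#roots as) + length rest                ≤⟨ ℕₚ.+-monoˡ-≤ (length rest) (sweep as off covered) ⟩
      (F.#roots off + V.#roots (off ʳ++ as) + length off) + length rest
        ≤⟨ ℕₚ.+-monoˡ-≤ (length rest) (ℕₚ.+-monoˡ-≤ (length off) (ℕₚ.+-mono-≤ (F.#roots-connected off one-face) (V.#roots-connected (off ʳ++ as) (V-all everything)))) ⟩
      (2 + length off) + length rest                  ≡⟨ regroup (length off) (length rest) ⟩
      1 + (suc (length rest) + length off)            ≤⟨ s≤s few-edges ⟩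
      1 + m                                           <⟨ ℕₚ.≤-refl ⟩
      2 + m                                           ≡⟨ ℕₚ.+-comm 2 m ⟩
      m + 2                                           ∎)
      where
      open ℕₚ.≤-Reasoning

      as : List (Fin m)
      as = edgeOf d₀ ∷ rest

      shuffle : ∀ a b c → (a + b) + c ≡ (c + a) + b
      shuffle = ℕ-Solver.solve-∀

      regroup : ∀ a b → (2 + a) + b ≡ 1 + (suc b + a)
      regroup = ℕ-Solver.solve-∀

      everything : ∀ e → e ∈ off ʳ++ as
      everything e = Anyₚ.reverseAcc⁺ as off (covered e)

      one-face : ∀ f g → F.label off f ≡ F.label off g
      one-face f g = trans (sym (from-d₀ f)) (from-d₀ g)
        where
        from-d₀ : ∀ f → F.label off (face d₀) ≡ F.label off f
        from-d₀ f = F-off ([ id , meet ◅◅_ ]′ (two-sides f))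

-- The area form

sum-zero : ∀ {n} {f : Fin n → ℤ} → (∀ i → f i ≡ 0ℤ) → sum f ≡ 0ℤ
sum-zero {n} f≡0 = trans (sum-cong-≗ f≡0) (sum-replicate-zero n)

sum-single : ∀ {n} (f : Fin n → ℤ) j → (∀ i → i ≢ j → f i ≡ 0ℤ) → sum f ≡ f j
sum-single f zero    off = trans (cong (ℤ._+_ (f zero)) (sum-zero (λ i → off (suc i) λ ()))) (ℤₚ.+-identityʳ _)
sum-single f (suc j) off = trans (cong₂ ℤ._+_ (off zero λ ()) (sum-single (f ∘ suc) j λ i i≢j → off (suc i) (i≢j ∘ Finₚ.suc-injective)))
                                 (ℤₚ.+-identityˡ _)

sum-neg : ∀ {n} (f : Fin n → ℤ) → sum (λ i → ℤ.- f i) ≡ ℤ.- sum f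
sum-neg {zero}  f = refl
sum-neg {suc n} f = trans (cong (ℤ._+_ (ℤ.- f zero)) (sum-neg (f ∘ suc))) (sym (ℤₚ.neg-distrib-+ (f zero) (sum (f ∘ suc))))

sum-sub : ∀ {n} (f g : Fin n → ℤ) → sum (λ i → f i ℤ.- g i) ≡ sum f ℤ.- sum g
sum-sub f g = trans (∑-distrib-+ f (ℤ.-_ ∘ g)) (cong (ℤ._+_ (sum f)) (sum-neg g))

sum-mono-≤ : ∀ {n} {f g : Fin n → ℤ} → (∀ i → f i ℤ.≤ g i) → sum f ℤ.≤ sum g
sum-mono-≤ {zero}  f≤g = ℤₚ.≤-refl
sum-mono-≤ {suc n} f≤g = ℤₚ.+-mono-≤ (f≤g zero) (sum-mono-≤ (f≤g ∘ suc))

sum-mono-< : ∀ {n} {f g : Fin n → ℤ} → (∀ i → f i ℤ.≤ g i) → ∀ j → f j ℤ.< g j → sum f ℤ.< sum g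
sum-mono-< f≤g zero    fj<gj = ℤₚ.+-mono-<-≤ fj<gj (sum-mono-≤ (f≤g ∘ suc))
sum-mono-< f≤g (suc j) fj<gj = ℤₚ.+-mono-≤-< (f≤g zero) (sum-mono-< (f≤g ∘ suc) j fj<gj)

indicator : {A : Set} → Dec A → ℤ
indicator p = if does p then 1ℤ else 0ℤ

indicator-true : {A : Set} (p : Dec A) → A → indicator p ≡ 1ℤ
indicator-true p a rewrite dec-true p a = refl

indicator-false : {A : Set} (p : Dec A) → ¬ A → indicator p ≡ 0ℤ
indicator-false p ¬a rewrite dec-false p ¬a = refl

indicator-⇔ : {A B : Set} (p : Dec A) (q : Dec B) → (A → B) → (B → A) → indicator p ≡ indicator q
indicator-⇔ (yes a) q f g = sym (indicator-true q (f a))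
indicator-⇔ (no ¬a) q f g = sym (indicator-false q (¬a ∘ g))

module Area (M : PlaneMap) where
  open PlaneMap M
  open Planar M

  -- The signed crossing of `y` with the dual edge from `face x` to `face (α x)`: 1 if `y` is `x`,
  -- -1 if it is the reverse of `x`, and 0 otherwise.
  δ : Dart m → Dart m → ℤ
  δ x y = indicator (x ≟ᵈ y) ℤ.- indicator (α x ≟ᵈ y)

  δ-α : ∀ x y → δ x (α y) ≡ ℤ.- δ x y
  δ-α x y = trans (cong₂ ℤ._-_ (indicator-⇔ (x ≟ᵈ α y) (α x ≟ᵈ y) (λ { refl → αα y }) (λ { refl → sym (αα x) }))
                               (indicator-⇔ (α x ≟ᵈ α y) (x ≟ᵈ y) α-injective (cong α)))
                  (swap (indicator (x ≟ᵈ y)) (indicator (α x ≟ᵈ y)))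
    where
    swap : ∀ a b → b ℤ.- a ≡ ℤ.- (a ℤ.- b)
    swap = solve-∀

  DualPath : Fin nF → Fin nF → Set
  DualPath = Star (λ f g → ∃ λ d → face d ≡ f × face (α d) ≡ g)

  crossings : ∀ {f g} → DualPath f g → Dart m → ℤ
  crossings ε                 y = 0ℤ
  crossings ((x , _ , _) ◅ p) y = δ x y ℤ.+ crossings p y

  crossings-α : ∀ {f g} (p : DualPath f g) y → crossings p (α y) ≡ ℤ.- crossings p y
  crossings-α ε y = refl
  crossings-α ((x , _ , _) ◅ p) y =
    trans (cong₂ ℤ._+_ (δ-α x y) (crossings-α p y)) (sym (ℤₚ.neg-distrib-+ (δ x y) (crossings p y)))

  pathToOuter : ∀ f → DualPath f outer
  pathToOuter f with face-surj f | face-surj outer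
  ... | x , refl | y , eq = subst (DualPath (face x)) eq (Star.gmap face through (connected x y))
    where
    through : ∀ {x y} → (y ≡ σ x) ⊎ (y ≡ α x) → ∃ λ d → face d ≡ face x × face (α d) ≡ face y
    through {x} (inj₁ refl) = α (σ x) , face-ασ x , cong face (αα (σ x))
    through {x} (inj₂ refl) = x , refl , refl

  -- The exterior derivative of ψ is 1 on every inner face, so that ψ integrates along a cycle to
  -- the number of faces enclosed, signed by its direction.
  ψ : Dart m → ℤ
  ψ d = sum (λ f → crossings (pathToOuter f) d)

  ψ-α : ∀ d → ψ (α d) ≡ ℤ.- ψ d
  ψ-α d = trans (sum-cong-≗ (λ f → crossings-α (pathToOuter f) d)) (sum-neg (λ f → crossings (pathToOuter f) d))

  ∮ψ : Cycle M → ℤ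
  ∮ψ c = sum (ψ ∘ dart c)

  module _ (c : Cycle M) where
    open OffCycle c

    -- The indicator function of the region on the left of `c`; by `jordan` it does not depend on
    -- which alternative `two-sides` returns.
    side : Fin nF → ℤ
    side f = [ (λ _ → 1ℤ) , (λ _ → 0ℤ) ]′ (two-sides f)

    side-left : ∀ {f} → face d₀ ~ f → side f ≡ 1ℤ
    side-left {f} p with two-sides f
    ... | inj₁ _ = refl
    ... | inj₂ q = ⊥-elim (jordan (p ◅◅ ~-sym q))

    side-right : ∀ {f} → face (α d₀) ~ f → side f ≡ 0ℤ
    side-right {f} q with two-sides f
    ... | inj₁ p = ⊥-elim (jordan (p ◅◅ ~-sym q))
    ... | inj₂ _ = refl

    side-~ : ∀ {f g} → f ~ g → side f ≡ side g
    side-~ {f} p with two-sides f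
    ... | inj₁ q = sym (side-left (q ◅◅ p))
    ... | inj₂ q = sym (side-right (q ◅◅ p))

    side-bounds : ∀ f → 0ℤ ℤ.≤ side f × side f ℤ.≤ 1ℤ
    side-bounds f with two-sides f
    ... | inj₁ _ = ℤ.+≤+ ℕ.z≤n , ℤₚ.≤-refl
    ... | inj₂ _ = ℤₚ.≤-refl , ℤ.+≤+ ℕ.z≤n

    visits : Dart m → ℤ
    visits x = sum (λ i → indicator (x ≟ᵈ dart c i))

    visits-on : ∀ j → visits (dart c j) ≡ 1ℤ
    visits-on j = trans
      (sum-single (λ i → indicator (dart c j ≟ᵈ dart c i)) j λ i i≢j →
        indicator-false (dart c j ≟ᵈ dart c i) (λ eq → i≢j (simpleE c i j (sym (cong edgeOf eq)))))
      (indicator-true (dart c j ≟ᵈ dart c j) refl)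

    visits-off : ∀ {x} → (∀ i → x ≢ dart c i) → visits x ≡ 0ℤ
    visits-off {x} off = sum-zero (λ i → indicator-false (x ≟ᵈ dart c i) (off i))

    visits-α : ∀ j → visits (α (dart c j)) ≡ 0ℤ
    visits-α j = visits-off λ i eq →
      d≢αd (dart c j) (trans (cong (dart c) (simpleE c j i (cong edgeOf eq))) (sym eq))

    -- A dual edge changes sides only where it crosses the cycle: from left to right if the cycle
    -- traverses `x`, from right to left if it traverses `α x`.
    ∮δ : ∀ x → sum (δ x ∘ dart c) ≡ side (face x) ℤ.- side (face (α x))
    ∮δ x = trans (sum-sub (λ i → indicator (x ≟ᵈ dart c i)) (λ i → indicator (α x ≟ᵈ dart c i))) (jump x)
      where
      jump : ∀ x → visits x ℤ.- visits (α x) ≡ side (face x) ℤ.- side (face (α x))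
      jump x with onCycle? (edgeOf x)
      ... | no off = trans (cong₂ ℤ._-_ (visits-off (λ i eq → off (i , sym (cong edgeOf eq))))
                                        (visits-off (λ i eq → off (i , sym (cong edgeOf eq)))))
                           (sym (ℤₚ.i≡j⇒i-j≡0 (side-~ (cross off))))
      ... | yes (j , eq) with sameEdge {d = x} {d' = dart c j} (sym eq)
      ...   | inj₁ refl = cong₂ ℤ._-_ (trans (visits-on j) (sym (side-left (left-side j))))
                                      (trans (visits-α j) (sym (side-right (right-side j))))
      ...   | inj₂ refl = cong₂ ℤ._-_
        (trans (visits-α j) (sym (side-right (right-side j))))
        (trans (cong visits (αα (dart c j)))
          (trans (visits-on j) (sym (trans (cong (side ∘ face) (αα (dart c j))) (side-left (left-side j))))))

    ∮crossings : ∀ {f g} (p : DualPath f g) → sum (crossings p ∘ dart c) ≡ side f ℤ.- side g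
    ∮crossings {f} ε = trans (sum-replicate-zero (suc (len-1 c))) (sym (ℤₚ.+-inverseʳ (side f)))
    ∮crossings {g = g} ((x , refl , refl) ◅ p) =
      trans (∑-distrib-+ (δ x ∘ dart c) (crossings p ∘ dart c))
            (trans (cong₂ ℤ._+_ (∮δ x) (∮crossings p)) (telescope (side (face x)) (side (face (α x))) (side g)))
      where
      telescope : ∀ a b c → (a ℤ.- b) ℤ.+ (b ℤ.- c) ≡ a ℤ.- c
      telescope = solve-∀

    -- Exchanging the sums over darts and faces evaluates each dual path separately, and its
    -- crossings with `c` depend only on the sides of its two ends.
    stokes : ∮ψ c ≡ sum (λ f → side f ℤ.- side outer)
    stokes = trans (∑-comm (λ i f → crossings (pathToOuter f) (dart c i)))
                   (sum-cong-≗ (λ f → ∮crossings (pathToOuter f)))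

    -- No term of `stokes` is positive, and the face on the right of the first dart contributes -1.
    outerLeft⇒∮ψ<0 : OuterOnLeft M c → ∮ψ c ℤ.< 0ℤ
    outerLeft⇒∮ψ<0 left = subst₂ ℤ._<_ (sym stokes) (sum-replicate-zero nF)
      (sum-mono-< (λ f → ℤₚ.i≤j⇒i-j≤0 (subst (side f ℤ.≤_) (sym (side-left left)) (proj₂ (side-bounds f))))
                  (face (α d₀))
                  (subst₂ (λ a b → a ℤ.- b ℤ.< 0ℤ) (sym (side-right ε)) (sym (side-left left)) ℤ.-<+))

    outerRight⇒0<∮ψ : OuterOnRight M c → 0ℤ ℤ.< ∮ψ c
    outerRight⇒0<∮ψ right = subst₂ ℤ._<_ (sum-replicate-zero nF) (sym stokes)
      (sum-mono-< (λ f → ℤₚ.i≤j⇒0≤j-i (subst (ℤ._≤ side f) (sym (side-right right)) (proj₁ (side-bounds f))))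
                  (face d₀)
                  (subst₂ (λ a b → 0ℤ ℤ.< a ℤ.- b) (sym (side-left ε)) (sym (side-right right)) (ℤ.+<+ (ℕ.s≤s ℕ.z≤n))))

    left⊎right : OuterOnLeft M c ⊎ OuterOnRight M c
    left⊎right = two-sides outer

    ∮ψ≢0 : ∮ψ c ≢ 0ℤ
    ∮ψ≢0 eq with left⊎right
    ... | inj₁ l = ℤₚ.<-irrefl eq (outerLeft⇒∮ψ<0 l)
    ... | inj₂ r = ℤₚ.<-irrefl (sym eq) (outerRight⇒0<∮ψ r)

    ∮ψ<0⇒outerLeft : ∮ψ c ℤ.< 0ℤ → OuterOnLeft M c
    ∮ψ<0⇒outerLeft neg with left⊎right
    ... | inj₁ l = l
    ... | inj₂ r = ⊥-elim (ℤₚ.<-asym neg (outerRight⇒0<∮ψ r))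

-- Walks and heaviest walks

lookup-injective : {A B : Set} (f : A → B) {xs : List A} → AllPairs (λ x y → f x ≢ f y) xs →
  ∀ i j → f (lookup xs i) ≡ f (lookup xs j) → i ≡ j
lookup-injective f (_ ∷ _)  zero    zero    eq = refl
lookup-injective f (x≢ ∷ _) zero    (suc j) eq = ⊥-elim (All.lookup x≢ (∈-lookup j) eq)
lookup-injective f (x≢ ∷ _) (suc i) zero    eq = ⊥-elim (All.lookup x≢ (∈-lookup i) (sym eq))
lookup-injective f (_ ∷ u)  (suc i) (suc j) eq = cong suc (lookup-injective f u i j eq)

-- `P` selects the admissible darts. It is instantiated with the oriented darts for existence, and
-- with both darts of every edge of a tree for uniqueness.
module Walks (M : PlaneMap) (P : Dart (PlaneMap.m M) → Set) where
  open PlaneMap M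
  open Planar M
  open Area M
  open import Data.List.Membership.DecPropositional (Finₚ._≟_ {n = nV}) using (_∈?_)

  Arc : Fin nV → Fin nV → Set
  Arc u w = ∃ λ d → vert d ≡ u × vert (α d) ≡ w × P d

  Walk : Fin nV → Fin nV → Set
  Walk = Star Arc

  weight : ∀ {u v} → Walk u v → ℤ
  weight ε             = 0ℤ
  weight ((d , _) ◅ w) = ψ d ℤ.+ weight w

  darts : ∀ {u v} → Walk u v → List (Dart m)
  darts ε             = []
  darts ((d , _) ◅ w) = d ∷ darts w

  vertices : ∀ {u v} → Walk u v → List (Fin nV)
  vertices {u} ε       = u ∷ []
  vertices {u} (_ ◅ w) = u ∷ vertices w

  Simple : ∀ {u v} → Walk u v → Set
  Simple w = Unique (vertices w)

  weight-◅◅ : ∀ {u v w} (p : Walk u v) (q : Walk v w) → weight (p ◅◅ q) ≡ weight p ℤ.+ weight q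
  weight-◅◅ ε             q = sym (ℤₚ.+-identityˡ _)
  weight-◅◅ ((d , _) ◅ p) q = trans (cong (ℤ._+_ (ψ d)) (weight-◅◅ p q)) (sym (ℤₚ.+-assoc (ψ d) _ _))

  start∈ : ∀ {u v} (w : Walk u v) → u ∈ vertices w
  start∈ ε       = here refl
  start∈ (_ ◅ _) = here refl

  end∈ : ∀ {u v} (w : Walk u v) → v ∈ vertices w
  end∈ ε       = here refl
  end∈ (_ ◅ w) = there (end∈ w)

  darts-P : ∀ {u v} (w : Walk u v) → All P (darts w)
  darts-P ε                      = []
  darts-P ((_ , _ , _ , pd) ◅ w) = pd ∷ darts-P w

  tail∈ : ∀ {u v x} (w : Walk u v) → x ∈ darts w → vert x ∈ vertices w
  tail∈ ((_ , refl , _) ◅ w) (here refl) = here refl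
  tail∈ (_ ◅ w)              (there x∈)  = there (tail∈ w x∈)

  head∈ : ∀ {u v x} (w : Walk u v) → x ∈ darts w → vert (α x) ∈ vertices w
  head∈ ((_ , _ , refl , _) ◅ w) (here refl) = there (start∈ w)
  head∈ (_ ◅ w)                  (there x∈)  = there (head∈ w x∈)

  length-vertices : ∀ {u v} (w : Walk u v) → length (vertices w) ≡ suc (length (darts w))
  length-vertices ε       = refl
  length-vertices (_ ◅ w) = cong suc (length-vertices w)

  simple-length : ∀ {u v} (w : Walk u v) → Simple w → length (darts w) ℕ.≤ nV
  simple-length w s = ℕₚ.≤-trans (ℕₚ.n≤1+n _) (subst (ℕ._≤ nV) (length-vertices w) (unique⇒length≤ s))

  simple-loop : ∀ {u} (w : Walk u u) → Simple w → weight w ≡ 0ℤ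
  simple-loop ε       _        = refl
  simple-loop (_ ◅ w) (u≢ ∷ _) = ⊥-elim (All.lookup u≢ (end∈ w) refl)

  tail≢end : ∀ {u v x} (w : Walk u v) → Simple w → x ∈ darts w → vert x ≢ v
  tail≢end ((_ , refl , _) ◅ w) (u≢ ∷ _) (here refl) eq = All.lookup u≢ (end∈ w) eq
  tail≢end (_ ◅ w)              (_ ∷ s)  (there x∈)  eq = tail≢end w s x∈ eq

  simple-tails : ∀ {u v} (w : Walk u v) → Simple w → AllPairs (λ x y → vert x ≢ vert y) (darts w)
  simple-tails ε _ = []
  simple-tails ((_ , refl , _) ◅ w) (u≢ ∷ s) =
    All.tabulate (λ x∈ → All.lookup u≢ (tail∈ w x∈)) ∷ simple-tails w s

  simple-edges : ∀ {u v} (w : Walk u v) → Simple w → AllPairs (λ x y → edgeOf x ≢ edgeOf y) (darts w)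
  simple-edges ε _ = []
  simple-edges ((d , refl , _) ◅ w) (u≢ ∷ s) = All.tabulate fresh ∷ simple-edges w s
    where
    fresh : ∀ {x} → x ∈ darts w → edgeOf d ≢ edgeOf x
    fresh {x} x∈ eq with sameEdge {d = d} {d' = x} eq
    ... | inj₁ refl = All.lookup u≢ (tail∈ w x∈) refl
    ... | inj₂ refl = All.lookup u≢ (head∈ w x∈) refl

  split : ∀ {u v x} (p : Walk u v) → Simple p → x ∈ vertices p →
    Σ (Walk u x) λ q → Σ (Walk x v) λ p' →
      Simple q × Simple p' × weight p ≡ weight q ℤ.+ weight p' × vertices q ⊆ vertices p
  split p@ε       s (here refl) = ε , p , [] ∷ [] , s , refl , id
  split p@(_ ◅ _) s (here refl) = ε , p , [] ∷ [] , s , sym (ℤₚ.+-identityˡ _) , λ { (here refl) → here refl }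
  split (a ◅ p) (u≢ ∷ s) (there x∈) with split p s x∈
  ... | q , p' , sq , sp' , eq , q⊆p =
    a ◅ q , p' , All.tabulate (λ y∈ → All.lookup u≢ (q⊆p y∈)) ∷ sq , sp'
    , trans (cong (ℤ._+_ (ψ (proj₁ a))) eq) (sym (ℤₚ.+-assoc (ψ (proj₁ a)) _ _))
    , λ { (here refl) → here refl ; (there y∈) → there (q⊆p y∈) }

  -- A simple walk from the head of `d` back to its tail closes up to a simple cycle. The hypothesis
  -- `new` excludes the walk that returns along the edge of `d` itself.
  module Closing (d : Dart m) (w : Walk (vert (α d)) (vert d)) (s : Simple w)
                 (new : All (λ x → edgeOf d ≢ edgeOf x) (darts w)) where

    consecutive : ∀ {u v} x (p : Walk u v) → vert (α x) ≡ u → ∀ i →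
      vert (α (lookup (x ∷ darts p) (inject₁ i))) ≡ vert (lookup (darts p) i)
    consecutive x ((y , refl , refl , _) ◅ p) eq zero    = eq
    consecutive x ((y , refl , refl , _) ◅ p) eq (suc i) = consecutive y p refl i

    final : ∀ {u v} x (p : Walk u v) → vert (α x) ≡ u →
      vert (α (lookup (x ∷ darts p) (fromℕ (length (darts p))))) ≡ v
    final x ε                           eq = eq
    final x ((y , refl , refl , _) ◅ p) eq = final y p refl

    cycle : Cycle M
    cycle = record
      { len-1   = length (darts w)
      ; dart    = lookup (d ∷ darts w)
      ; chain   = consecutive d w refl
      ; close   = final d w refl
      ; simpleV = lookup-injective vert (All.tabulate (λ x∈ eq → tail≢end w s x∈ (sym eq)) ∷ simple-tails w s)
      ; simpleE = lookup-injective edgeOf (new ∷ simple-edges w s)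
      }

    ∮ψ-cycle : ∮ψ cycle ≡ ψ d ℤ.+ weight w
    ∮ψ-cycle = cong (ℤ._+_ (ψ d)) (go w)
      where
      go : ∀ {u v} (p : Walk u v) → sum (ψ ∘ lookup (darts p)) ≡ weight p
      go ε             = refl
      go ((x , _) ◅ p) = cong (ℤ._+_ (ψ x)) (go p)

  -- The condition under which cutting loops out of a walk never lowers its weight.
  NonPositive : Set
  NonPositive = ∀ (c : Cycle M) → (∀ i → P (dart c i)) → ∮ψ c ℤ.≤ 0ℤ

  module _ (nonPos : NonPositive) where

    -- The dart `α d` leaves the start of the walk, so in a simple walk it comes first; it already
    -- reaches the end, and what follows is a simple loop and hence empty.
    backtrack : ∀ {u} d (w : Walk u (vert d)) → u ≡ vert (α d) → Simple w → α d ∈ darts w → weight w ≡ ψ (α d)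
    backtrack d ((_ , refl , refl , _) ◅ w) eq (u≢ ∷ s) (here refl) =
      trans (cong (ℤ._+_ (ψ (α d))) (loop w (cong vert (αα d)) s)) (ℤₚ.+-identityʳ _)
      where
      loop : ∀ {u v} (w : Walk u v) → u ≡ v → Simple w → weight w ≡ 0ℤ
      loop w refl s = simple-loop w s
    backtrack d ((_ , refl , _) ◅ w) eq (u≢ ∷ s) (there x∈) =
      ⊥-elim (All.lookup u≢ (tail∈ w x∈) eq)

    -- Either `d` and `w` form a genuine cycle, or `w` goes back along `d` and the two weights
    -- cancel.
    closed-nonPositive : ∀ d → P d → (w : Walk (vert (α d)) (vert d)) → Simple w → ψ d ℤ.+ weight w ℤ.≤ 0ℤ
    closed-nonPositive d pd w s with Any.any? (λ x → edgeOf d Finₚ.≟ edgeOf x) (darts w)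
    ... | no new = subst (ℤ._≤ 0ℤ) (∮ψ-cycle) (nonPos cycle λ i → All.lookup (pd ∷ darts-P w) (∈-lookup i))
      where open Closing d w s (¬Any⇒All¬ _ new)
    ... | yes old = ℤₚ.≤-reflexive (trans (cong (ℤ._+_ (ψ d)) (trans (backtrack d w refl s (found old)) (ψ-α d)))
                                          (ℤₚ.+-inverseʳ (ψ d)))
      where
      reversed : ∀ {x} → x ∈ darts w → edgeOf d ≡ edgeOf x → α d ≡ x
      reversed {x} x∈ eq with sameEdge {d = d} {d' = x} eq
      ... | inj₁ refl = ⊥-elim (tail≢end w s x∈ refl)
      ... | inj₂ refl = αα x

      found : Any (λ x → edgeOf d ≡ edgeOf x) (darts w) → α d ∈ darts w
      found old with find old
      ... | x , x∈ , eq = subst (_∈ darts w) (sym (reversed x∈ eq)) x∈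

    -- If the simplified remainder meets the tail of the first dart again, the loop up to there is
    -- dropped; its weight is at most 0 by `closed-nonPositive`.
    simplify : ∀ {u v} (w : Walk u v) → Σ (Walk u v) λ p → Simple p × weight w ℤ.≤ weight p
    simplify ε = ε , [] ∷ [] , ℤₚ.≤-refl
    simplify (a@(d , refl , refl , pd) ◅ w) with simplify w
    ... | p , s , w≤p with vert d ∈? vertices p
    ...   | no d∉ = a ◅ p , ¬Any⇒All¬ _ d∉ ∷ s , ℤₚ.+-monoʳ-≤ (ψ d) w≤p
    ...   | yes d∈ with split p s d∈
    ...     | q , p' , sq , sp' , eq , _ = p' , sp' , (begin
      ψ d ℤ.+ weight w                      ≤⟨ ℤₚ.+-monoʳ-≤ (ψ d) w≤p ⟩
      ψ d ℤ.+ weight p                      ≡⟨ cong (ℤ._+_ (ψ d)) eq ⟩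
      ψ d ℤ.+ (weight q ℤ.+ weight p')      ≡⟨ ℤₚ.+-assoc (ψ d) _ _ ⟨
      (ψ d ℤ.+ weight q) ℤ.+ weight p'      ≤⟨ ℤₚ.+-monoˡ-≤ (weight p') (closed-nonPositive d pd q sq) ⟩
      0ℤ ℤ.+ weight p'                      ≡⟨ ℤₚ.+-identityˡ _ ⟩
      weight p'                             ∎)
      where open ℤₚ.≤-Reasoning

    loop-nonPositive : ∀ {u} (w : Walk u u) → weight w ℤ.≤ 0ℤ
    loop-nonPositive w with simplify w
    ... | p , s , w≤p = subst (weight w ℤ.≤_) (simple-loop p s) w≤p

    -- Attainment of the maximal weight

    module _ (P? : ∀ d → Dec (P d)) (r : Fin nV) where

      allDarts : List (Dart m)
      allDarts = cartesianProduct (allFin m) (true ∷ false ∷ [])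

      ∈-allDarts : ∀ d → d ∈ allDarts
      ∈-allDarts (e , true)  = ∈-cartesianProduct⁺ (∈-allFin e) (here refl)
      ∈-allDarts (e , false) = ∈-cartesianProduct⁺ (∈-allFin e) (there (here refl))

      stop : ∀ u → List (Walk u r)
      stop u with u Finₚ.≟ r
      ... | yes refl = ε ∷ []
      ... | no _     = []

      mutual
        walks : ℕ → ∀ u → List (Walk u r)
        walks zero    u = stop u
        walks (suc n) u = stop u ++ concatMap (walksVia n u) allDarts

        walksVia : ℕ → ∀ u → Dart m → List (Walk u r)
        walksVia n u d with vert d Finₚ.≟ u | P? d
        ... | yes eq | yes pd = map ((d , eq , refl , pd) ◅_) (walks n (vert (α d)))
        ... | yes _  | no _   = []
        ... | no _   | _      = []

      stop-complete : ∀ {u} → u ≡ r → Any (λ w → weight w ≡ 0ℤ) (stop u)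
      stop-complete {u} u≡r with u Finₚ.≟ r
      ... | yes refl = here refl
      ... | no u≢r   = ⊥-elim (u≢r u≡r)

      -- Only the weight is recovered, because the listed walk may carry other proofs of `P` and of
      -- incidence.
      walks-complete : ∀ n {u} (w : Walk u r) → length (darts w) ℕ.≤ n →
        Any (λ w' → weight w' ≡ weight w) (walks n u)
      walks-complete zero    ε _ = stop-complete refl
      walks-complete (suc n) ε _ = Anyₚ.++⁺ˡ (stop-complete refl)
      walks-complete (suc n) {u} ((d , du , refl , pd) ◅ w) (ℕ.s≤s len) =
        Anyₚ.++⁺ʳ (stop u) (Anyₚ.concatMap⁺ (walksVia n u) (Any.map via (∈-allDarts d)))
        where
        via : ∀ {x} → d ≡ x → Any (λ w' → weight w' ≡ ψ d ℤ.+ weight w) (walksVia n u x)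
        via refl with vert d Finₚ.≟ u | P? d
        ... | yes _ | yes _  = Anyₚ.map⁺ (Any.map (cong (ℤ._+_ (ψ d))) (walks-complete n w len))
        ... | yes _ | no ¬pd = ⊥-elim (¬pd pd)
        ... | no ¬e | _      = ⊥-elim (¬e du)

      heaviest : ∀ {u} → Walk u r → Σ (Walk u r) λ w → ∀ w' → weight w' ℤ.≤ weight w
      -- Simple walks have at most `nV` darts, so the finite list contains a walk of the weight of
      -- each; `w₀` is the default of `argmax`.
      heaviest {u} w₀ = argmax weight w₀ (walks nV u) , λ w' →
        let p , s , w'≤p = simplify w' in
        ℤₚ.≤-trans w'≤p (v≤f[argmax]⁺ w₀ (walks nV u)
          (inj₂ (Any.map (ℤₚ.≤-reflexive ∘ sym) (walks-complete nV p (simple-length p s)))))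

-- Certificates for good partitions

telescope : ∀ n (a b : Fin (suc n) → ℤ) → (∀ i → b (inject₁ i) ≡ a (suc i)) →
  sum (λ i → a i ℤ.- b i) ≡ a zero ℤ.- b (fromℕ n)
telescope zero    a b eq = ℤₚ.+-identityʳ _
telescope (suc n) a b eq =
  trans (cong (ℤ._+_ (a zero ℤ.- b zero)) (telescope n (a ∘ suc) (b ∘ suc) (eq ∘ suc)))
        (trans (cong (λ z → (a zero ℤ.- z) ℤ.+ (a (suc zero) ℤ.- b (fromℕ (suc n)))) (eq zero))
               (collapse (a zero) (a (suc zero)) (b (fromℕ (suc n)))))
  where
  collapse : ∀ x y z → (x ℤ.- y) ℤ.+ (y ℤ.- z) ≡ x ℤ.- z
  collapse = solve-∀

module Partition (M : PlaneMap) (r : Fin (PlaneMap.nV M)) (k : ℕ) (k≥1 : 1 ℕ.≤ k) (O : FracOrientation M k) where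
  open PlaneMap M
  open Planar M
  open Area M
  open FracOrientation O

  Oriented : Dart m → Set
  Oriented = PartOriented M O

  oriented? : ∀ d → Dec (Oriented d)
  oriented? (e , true)  = 1 ℕₚ.≤? amount e
  oriented? (e , false) = amount e ℕₚ.<? k

  oriented-either : ∀ d → Oriented d ⊎ Oriented (α d)
  oriented-either (e , b) with amount e ℕₚ.≟ 0 | b
  ... | yes eq | true  = inj₂ (subst (ℕ._< k) (sym eq) k≥1)
  ... | yes eq | false = inj₁ (subst (ℕ._< k) (sym eq) k≥1)
  ... | no neq | true  = inj₁ (ℕₚ.n≢0⇒n>0 neq)
  ... | no neq | false = inj₂ (ℕₚ.n≢0⇒n>0 neq)

  fully⇒oriented : ∀ d → FullyOriented M O d → Oriented d
  fully⇒oriented (e , true)  eq = subst (1 ℕ.≤_) (sym eq) k≥1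
  fully⇒oriented (e , false) eq = subst (ℕ._< k) (sym eq) k≥1

  saturated⇒fully : ∀ d → Saturated M O (edgeOf d) → Oriented d → FullyOriented M O d
  saturated⇒fully (e , true)  (inj₁ eq) o = ⊥-elim (ℕₚ.<⇒≢ o (sym eq))
  saturated⇒fully (e , true)  (inj₂ eq) o = eq
  saturated⇒fully (e , false) (inj₁ eq) o = eq
  saturated⇒fully (e , false) (inj₂ eq) o = ⊥-elim (ℕₚ.<⇒≢ o eq)

  oneSided⇒saturated : ∀ e → (Oriented (e , true) → ¬ Oriented (e , false)) → Saturated M O e
  oneSided⇒saturated e one with amount e ℕₚ.≟ 0 | amount e ℕₚ.≟ k
  ... | yes eq | _      = inj₁ eq
  ... | no _   | yes eq = inj₂ eq
  ... | no ≢0  | no ≢k  = ⊥-elim (one (ℕₚ.n≢0⇒n>0 ≢0) (ℕₚ.≤∧≢⇒< (bound e) ≢k))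

  Tight : (Fin nV → ℤ) → Dart m → Set
  Tight g d = ψ d ≡ g (vert d) ℤ.- g (vert (α d))

  tight-α : ∀ {g} d → Tight g d → Tight g (α d)
  tight-α {g} d eq = trans (ψ-α d) (trans (cong ℤ.-_ eq) (trans (swap (g (vert d)) (g (vert (α d))))
    (cong (λ x → g (vert (α d)) ℤ.- g (vert x)) (sym (αα d)))))
    where
    swap : ∀ a b → ℤ.- (a ℤ.- b) ≡ b ℤ.- a
    swap = solve-∀

  tight⇒ : ∀ {g} d → Tight g d → ψ d ℤ.+ g (vert (α d)) ≡ g (vert d)
  tight⇒ {g} d eq = trans (cong (ℤ._+ g (vert (α d))) eq) (cancel (g (vert d)) (g (vert (α d))))
    where
    cancel : ∀ a b → (a ℤ.- b) ℤ.+ b ≡ a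
    cancel = solve-∀

  ⇒tight : ∀ {g} d → ψ d ℤ.+ g (vert (α d)) ≡ g (vert d) → Tight g d
  ⇒tight {g} d eq = trans (cancel (ψ d) (g (vert (α d)))) (cong (ℤ._- g (vert (α d))) eq)
    where
    cancel : ∀ a b → a ≡ (a ℤ.+ b) ℤ.- b
    cancel = solve-∀

  -- The Bellman equation of the heaviest-walk problem with weights ψ.
  record Certificate (T : Fin m → Bool) : Set where
    field
      g      : Fin nV → ℤ
      g-root : g r ≡ 0ℤ
      tight  : ∀ d → T (edgeOf d) ≡ true → Tight g d
      strict : ∀ d → T (edgeOf d) ≡ false → Oriented d → ψ d ℤ.+ g (vert (α d)) ℤ.< g (vert d)
      reach  : AccessibleIn M O T r

    relaxed : ∀ d → Oriented d → ψ d ℤ.+ g (vert (α d)) ℤ.≤ g (vert d)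
    relaxed d o with T (edgeOf d) in eq
    ... | true  = ℤₚ.≤-reflexive (tight⇒ {g} d (tight d eq))
    ... | false = ℤₚ.<⇒≤ (strict d eq o)

    -- As `k` is positive, the edge is at least partially oriented in one direction, where `strict`
    -- applies; tightness passes to either direction.
    not-tight : ∀ d → T (edgeOf d) ≡ false → ¬ Tight g d
    not-tight d eq t with oriented-either d
    ... | inj₁ o = ℤₚ.<-irrefl (tight⇒ {g} d t) (strict d eq o)
    ... | inj₂ o = ℤₚ.<-irrefl (tight⇒ {g} (α d) (tight-α {g} d t)) (strict (α d) eq o)

  -- Uniqueness of the certificate

  module _ {T T' : Fin m → Bool} (C : Certificate T) (C' : Certificate T') where
    private
      module C  = Certificate C
      module C' = Certificate C'

    -- Along an oriented path to `r` in `T'`, the potential of `C'` changes by exactly `ψ`, while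
    -- that of `C` satisfies the relaxed inequality.
    potential-≤ : ∀ v → C'.g v ℤ.≤ C.g v
    potential-≤ v = go (C'.reach v)
      where
      go : ∀ {v} → Star (OStep M O T') v r → C'.g v ℤ.≤ C.g v
      go ε = ℤₚ.≤-reflexive (trans C'.g-root (sym C.g-root))
      go ((d , refl , refl , d∈ , o) ◅ w) = begin
        C'.g (vert d)                ≡⟨ tight⇒ {C'.g} d (C'.tight d d∈) ⟨
        ψ d ℤ.+ C'.g (vert (α d))    ≤⟨ ℤₚ.+-monoʳ-≤ (ψ d) (go w) ⟩
        ψ d ℤ.+ C.g (vert (α d))     ≤⟨ C.relaxed d o ⟩
        C.g (vert d)                 ∎
        where open ℤₚ.≤-Reasoning

  tight-transfer : ∀ {T T'} (C : Certificate T) (C' : Certificate T') {d} →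
    Tight (Certificate.g C) d → Tight (Certificate.g C') d
  tight-transfer C C' {d} t = trans t (cong₂ ℤ._-_ (same (vert d)) (same (vert (α d))))
    where
    same : ∀ v → Certificate.g C v ≡ Certificate.g C' v
    same v = ℤₚ.≤-antisym (potential-≤ C' C v) (potential-≤ C C' v)

  -- The potentials agree, and each edge set consists of exactly the edges tight for its potential.
  certificate-unique : ∀ {T T'} → Certificate T → Certificate T' → ∀ e → T' e ≡ T e
  certificate-unique {T} {T'} C C' e with T e in eq | T' e in eq'
  ... | true  | true  = refl
  ... | false | false = refl
  ... | true  | false = ⊥-elim (Certificate.not-tight C' (e , true) eq'
                          (tight-transfer C C' (Certificate.tight C (e , true) eq)))
  ... | false | true  = ⊥-elim (Certificate.not-tight C (e , true) eq
                          (tight-transfer C' C (Certificate.tight C' (e , true) eq')))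

  UStep-sym : ∀ T → Sym (UStep M T) (UStep M T)
  UStep-sym T (d , t , h , d∈) = α d , h , trans (cong vert (αα d)) t , d∈

  accessible⇒connected : ∀ T → AccessibleIn M O T r → ∀ u w → Star (UStep M T) u w
  accessible⇒connected T acc u w = unorient (acc u) ◅◅ Star.reverse (UStep-sym T) (unorient (acc w))
    where
    unorient : ∀ {v} → Star (OStep M O T) v r → Star (UStep M T) v r
    unorient = Star.map λ (d , t , h , d∈ , _) → d , t , h , d∈

  -- From certificates to good partitions

  module _ {T : Fin m → Bool} (C : Certificate T) where
    open Certificate C

    slack : Dart m → ℤ
    slack d = ψ d ℤ.- (g (vert d) ℤ.- g (vert (α d)))

    -- The differences of the potential telescope to 0 around a cycle, so `ψ` may be replaced by its
    -- slack, which vanishes on `T`.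
    ∮ψ-slack : ∀ c → ∮ψ c ≡ sum (slack ∘ dart c)
    ∮ψ-slack c = sym (begin
      sum (slack ∘ dart c)                                                ≡⟨ sum-sub (ψ ∘ dart c) drop ⟩
      ∮ψ c ℤ.- sum drop                                                   ≡⟨ cong (ℤ._-_ (∮ψ c)) (telescope (len-1 c) (λ i → g (vert (dart c i))) (λ i → g (vert (α (dart c i)))) (λ i → cong g (chain c i))) ⟩
      ∮ψ c ℤ.- (g (vert (dart c zero)) ℤ.- g (vert (α (dart c (fromℕ (len-1 c))))))
        ≡⟨ cong (λ v → ∮ψ c ℤ.- (g (vert (dart c zero)) ℤ.- g v)) (close c) ⟩
      ∮ψ c ℤ.- (g (vert (dart c zero)) ℤ.- g (vert (dart c zero)))        ≡⟨ cancel (∮ψ c) (g (vert (dart c zero))) ⟩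
      ∮ψ c                                                                ∎)
      where
      open ≡-Reasoning
      drop : Fin (suc (len-1 c)) → ℤ
      drop i = g (vert (dart c i)) ℤ.- g (vert (α (dart c i)))
      cancel : ∀ a b → a ℤ.- (b ℤ.- b) ≡ a
      cancel = solve-∀

    slack-tight : ∀ d → T (edgeOf d) ≡ true → slack d ≡ 0ℤ
    slack-tight d d∈ = ℤₚ.i≡j⇒i-j≡0 (tight d d∈)

    slack-strict : ∀ d → T (edgeOf d) ≡ false → Oriented d → slack d ℤ.< 0ℤ
    slack-strict d d∉ o = subst₂ ℤ._<_ (rearrange (ψ d) (g (vert (α d))) (g (vert d))) (ℤₚ.+-inverseʳ (g (vert d)))
      (ℤₚ.+-monoˡ-< (ℤ.- g (vert d)) (strict d d∉ o))
      where
      rearrange : ∀ a b c → (a ℤ.+ b) ℤ.- c ≡ a ℤ.- (c ℤ.- b)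
      rearrange = solve-∀

    certificate⇒good : GoodPartition M O r T
    certificate⇒good = ((accessible⇒connected T reach , acyclic) , reach) , λ e e∉ → saturated e e∉ , clockwise e e∉
      where
      acyclic : ∀ c → ¬ (∀ i → T (edgeOf (dart c i)) ≡ true)
      acyclic c all = ∮ψ≢0 c (trans (∮ψ-slack c) (sum-zero (λ i → slack-tight (dart c i) (all i))))

      saturated : ∀ e → T e ≡ false → Saturated M O e
      -- If `e` were oriented both ways, the two strict inequalities would add up, by antisymmetry
      -- of `ψ`, to a number less than itself.
      saturated e e∉ = oneSided⇒saturated e λ o o' → ℤₚ.<-irrefl
        (balance (ψ (e , true)) (g (vert (e , true))) (g (vert (e , false))))
        (subst (λ x → (ψ (e , true) ℤ.+ g (vert (e , false))) ℤ.+ (x ℤ.+ g (vert (e , true))) ℤ.< g (vert (e , true)) ℤ.+ g (vert (e , false)))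
          (ψ-α (e , true)) (ℤₚ.+-mono-< (strict (e , true) e∉ o) (strict (e , false) e∉ o')))
        where
        balance : ∀ a b c → (a ℤ.+ c) ℤ.+ (ℤ.- a ℤ.+ b) ≡ b ℤ.+ c
        balance = solve-∀

      clockwise : ∀ e → T e ≡ false → ∀ d → edgeOf d ≡ e → FullyOriented M O d → ∀ c → dart c zero ≡ d →
        (∀ i → T (edgeOf (dart c (suc i))) ≡ true) → OuterOnLeft M c
      -- Only the first dart of the cycle has nonzero slack, and that slack is negative.
      clockwise e e∉ d refl full c refl rest = ∮ψ<0⇒outerLeft c (subst (ℤ._< 0ℤ)
        (sym (trans (∮ψ-slack c) (trans (cong (ℤ._+_ (slack d)) (sum-zero (λ i → slack-tight (dart c (suc i)) (rest i))))
                                        (ℤₚ.+-identityʳ _))))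
        (slack-strict d e∉ (fully⇒oriented d full)))

  -- From good partitions to certificates

  module _ (T : Fin m → Bool) (good : GoodPartition M O r T) where
    private
      module W = Walks M (λ d → T (edgeOf d) ≡ true)

    acyclic⇒nonPositive : W.NonPositive
    acyclic⇒nonPositive c all = ⊥-elim (proj₂ (proj₁ (proj₁ good)) c all)

    back : ∀ {u v} → W.Walk u v → W.Walk v u
    back ε = ε
    back ((d , t , h , d∈) ◅ w) = back w ◅◅ ((α d , h , trans (cong vert (αα d)) t , d∈) ◅ ε)

    weight-back : ∀ {u v} (w : W.Walk u v) → W.weight (back w) ≡ ℤ.- W.weight w
    weight-back ε = refl
    weight-back ((d , t , h , d∈) ◅ w) = trans (W.weight-◅◅ (back w) _)
      (trans (cong₂ ℤ._+_ (weight-back w) (trans (ℤₚ.+-identityʳ _) (ψ-α d))) (collect (W.weight w) (ψ d)))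
      where
      collect : ∀ a b → ℤ.- a ℤ.+ ℤ.- b ≡ ℤ.- (b ℤ.+ a)
      collect = solve-∀

    -- Following `p` and returning along `q` is a closed walk in `T`, of weight at most 0 since `T`
    -- has no cycles.
    weight-≤ : ∀ {u v} (p q : W.Walk u v) → W.weight p ℤ.≤ W.weight q
    weight-≤ p q = ℤₚ.i-j≤0⇒i≤j (subst (ℤ._≤ 0ℤ)
      (trans (W.weight-◅◅ p (back q)) (cong (ℤ._+_ (W.weight p)) (weight-back q)))
      (W.loop-nonPositive acyclic⇒nonPositive (p ◅◅ back q)))

    weight-unique : ∀ {u v} (p q : W.Walk u v) → W.weight p ≡ W.weight q
    weight-unique p q = ℤₚ.≤-antisym (weight-≤ p q) (weight-≤ q p)

    toRoot : ∀ v → W.Walk v r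
    toRoot v = Star.map (λ (d , t , h , d∈ , _) → d , t , h , d∈) (proj₂ (proj₁ good) v)

    good⇒certificate : Certificate T
    good⇒certificate = record
      { g      = λ v → W.weight (toRoot v)
      ; g-root = weight-unique (toRoot r) ε
      ; tight  = λ d d∈ → ⇒tight {λ v → W.weight (toRoot v)} d
                   (weight-unique ((d , refl , refl , d∈) ◅ toRoot (vert (α d))) (toRoot (vert d)))
      ; strict = strict
      ; reach  = proj₂ (proj₁ good)
      }
      where
      strict : ∀ d → T (edgeOf d) ≡ false → Oriented d →
        ψ d ℤ.+ W.weight (toRoot (vert (α d))) ℤ.< W.weight (toRoot (vert d))
      -- The simple walk `p` in `T` from the head to the tail of `d` closes with `d` to a cycle that
      -- has the outer face on its left. By path independence the weight of `p` is the potential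
      -- difference between its ends.
      strict d d∉ o with W.simplify acyclic⇒nonPositive (toRoot (vert (α d)) ◅◅ back (toRoot (vert d)))
      ... | p , s , _ = subst₂ ℤ._<_
        (trans (ℤₚ.+-assoc (ψ d) _ _) (cong (ℤ._+_ (ψ d))
          (trans (sym (W.weight-◅◅ p (toRoot (vert d)))) (weight-unique (p ◅◅ toRoot (vert d)) (toRoot (vert (α d)))))))
        (ℤₚ.+-identityˡ _)
        (ℤₚ.+-monoˡ-< (W.weight (toRoot (vert d))) (subst (ℤ._< 0ℤ) ∮ψ-cycle (outerLeft⇒∮ψ<0 cycle left)))
        where
        new : ∀ {x} → T (edgeOf x) ≡ true → edgeOf d ≢ edgeOf x
        new x∈ eq with trans (sym d∉) (trans (cong T eq) x∈)
        ... | ()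
        open W.Closing d p s (All.map (λ {x} → new {x}) (W.darts-P p))
        left : OuterOnLeft M cycle
        left = proj₂ (proj₂ good (edgeOf d) d∉) d refl
          (saturated⇒fully d (proj₁ (proj₂ good (edgeOf d) d∉)) o) cycle refl
          (λ i → All.lookup (W.darts-P p) (∈-lookup i))

  -- The certificate of a minimal accessible orientation

  module _ (minimal : Minimal M O) (accessible : Accessible M O r) where
    private
      module W = Walks M Oriented

    minimal⇒nonPositive : W.NonPositive
    minimal⇒nonPositive c oriented with left⊎right c
    ... | inj₁ l = ℤₚ.<⇒≤ (outerLeft⇒∮ψ<0 c l)
    ... | inj₂ r = ⊥-elim (minimal c oriented r)

    best : ∀ v → Σ (W.Walk v r) λ w → ∀ w' → W.weight w' ℤ.≤ W.weight w
    best v = W.heaviest minimal⇒nonPositive oriented? r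
      (Star.map (λ (d , t , h , _ , o) → d , t , h , o) (accessible v))

    height : Fin nV → ℤ
    height v = W.weight (proj₁ (best v))

    tight? : ∀ d → Dec (Tight height d)
    tight? d = ψ d ℤₚ.≟ (height (vert d) ℤ.- height (vert (α d)))

    tightEdges : Fin m → Bool
    tightEdges e = does (tight? (e , true))

    tightEdges-complete : ∀ d → Tight height d → tightEdges (edgeOf d) ≡ true
    tightEdges-complete (e , true)  t = dec-true (tight? (e , true)) t
    tightEdges-complete (e , false) t = dec-true (tight? (e , true)) (tight-α {height} (e , false) t)

    tightEdges-sound : ∀ d → tightEdges (edgeOf d) ≡ true → Tight height d
    tightEdges-sound (e , b) eq with tight? (e , true)
    tightEdges-sound (e , true)  eq | yes t = t
    tightEdges-sound (e , false) eq | yes t = tight-α {height} (e , true) t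

    relax : ∀ d → Oriented d → ψ d ℤ.+ height (vert (α d)) ℤ.≤ height (vert d)
    relax d o = proj₂ (best (vert d)) ((d , refl , refl , o) ◅ proj₁ (best (vert (α d))))

    -- The optimality principle: if `w` attains the maximum, so does each of its final segments,
    -- hence every dart of `w` is tight.
    heaviest-tight : ∀ {v} (w : W.Walk v r) → W.weight w ≡ height v → Star (OStep M O tightEdges) v r
    heaviest-tight ε _ = ε
    heaviest-tight ((d , refl , refl , o) ◅ w) eq =
      (d , refl , refl , tightEdges-complete d (⇒tight {height} d d-tight) , o) ◅ heaviest-tight w w-heaviest
      where
      h : ℤ
      h = height (vert (α d))

      d-tight : ψ d ℤ.+ h ≡ height (vert d)
      d-tight = ℤₚ.≤-antisym (relax d o)
        (subst (ℤ._≤ ψ d ℤ.+ h) eq (ℤₚ.+-monoʳ-≤ (ψ d) (proj₂ (best (vert (α d))) w)))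

      w-heaviest : W.weight w ≡ h
      w-heaviest = ∙-cancelˡ (ψ d) _ _ (trans eq (sym d-tight))

    tightEdges-certificate : Certificate tightEdges
    tightEdges-certificate = record
      { g      = height
      -- Closed walks at `r` weigh at most 0, and the empty walk attains 0.
      ; g-root = ℤₚ.≤-antisym (W.loop-nonPositive minimal⇒nonPositive (proj₁ (best r))) (proj₂ (best r) ε)
      ; tight  = tightEdges-sound
      ; strict = strict
      ; reach  = λ v → heaviest-tight (proj₁ (best v)) refl
      }
      where
      strict : ∀ d → tightEdges (edgeOf d) ≡ false → Oriented d → ψ d ℤ.+ height (vert (α d)) ℤ.< height (vert d)
      strict d d∉ o = ℤₚ.≤∧≢⇒< (relax d o) λ eq → true≢false (trans (sym (tightEdges-complete d (⇒tight {height} d eq))) d∉)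
        where
        true≢false : true ≢ false
        true≢false ()

theorem2p3 : (M : PlaneMap) (r : Fin (PlaneMap.nV M)) (k : ℕ) → 1 ≤ k →
    (O : FracOrientation M k) → Minimal M O → Accessible M O r →
    Σ (Fin (PlaneMap.m M) → Bool) (λ T → GoodPartition M O r T
    × ((T' : Fin (PlaneMap.m M) → Bool) → GoodPartition M O r T' → ∀ e → T' e ≡ T e))
theorem2p3 M r k k≥1 O minimal accessible =
  tightEdges minimal accessible ,
  certificate⇒good certificate ,
  λ T' good → certificate-unique certificate (good⇒certificate T' good)
  where
  open Partition M r k k≥1 O
  certificate = tightEdges-certificate minimal accessible
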